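{- Let $Q_3$ be the $3$-dimensional hypercube graph. Breaker has a winning strategy in the $1$-degree game played on $Q_3$; that is, $\delta_B(Q_3)=1$.
   Context: The graph $Q_3$ has vertex set $\{0,1\}^3$, two vertices being adjacent when they differ in exactly one coordinate. Degree game. Given a graph $G$, two players, Maker and Breaker, alternately claim previously unclaimed edges of $G$, one edge per turn, with Maker moving first, until all edges are claimed. In the $t$-degree game, Breaker wins if at the end every vertex is incident to at least $t$ edges claimed by Breaker; Maker wins if Maker claims at least $\deg_G(x)-t+1$ edges at some vertex $x$. In particular, in the $1$-degree game Breaker wins iff at the end every vertex is incident to at least one edge claimed by Breaker. $\delta_B(G)$ denotes the largest nonnegative integer $t$ for which Breaker has a winning strategy in the $t$-degree game on $G$. -}

module Defs where

open import Data.Bool using (Bool; true; false)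
import Data.Bool.Properties as Bool
open import Data.Fin using (Fin)
open import Data.List using (List; []; _∷_; _++_; map; filter; length; allFin)
open import Data.List.Membership.Propositional.Properties using (∈-++⁺ˡ; ∈-++⁺ʳ; ∈-map⁺)
open import Data.List.Properties using (filter-≐; filter-none)
open import Data.List.Relation.Unary.All using (universal)
open import Data.List.Relation.Unary.Any using (Any; here)
open import Data.List.Relation.Unary.Enumerates.Setoid using (IsEnumeration)
open import Data.Nat using (ℕ; zero; suc; _≤_)
import Data.Nat.Properties as ℕ
open import Data.Product using (Σ-syntax; ∃-syntax; _×_; _,_; proj₁)
open import Data.Sum using (_⊎_)
open import Data.Vec using (Vec; []; _∷_; lookup)
open import Data.Vec.Properties using (≡-dec)
open import Relation.Binary.Definitions
  using (Decidable; DecidableEquality; Symmetric; Irreflexive)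
open import Relation.Binary.PropositionalEquality
  using (_≡_; _≢_; refl; sym; trans; cong; setoid; ≢-sym)
open import Relation.Nullary using (¬_; Dec; ¬?; _⊎-dec_)

record FiniteSimpleGraph : Set₁ where
  field
    V          : Set
    _≟_        : DecidableEquality V
    vertices   : List V
    enumerates : IsEnumeration (setoid V) vertices
    Adj        : V → V → Set
    adj?       : Decidable Adj
    adj-sym    : Symmetric Adj
    adj-irrefl : Irreflexive _≡_ Adj

differingCoordinates : ∀ {n} → Vec Bool n → Vec Bool n → List (Fin n)
differingCoordinates {n} x y =
  filter (λ i → ¬? (lookup x i Bool.≟ lookup y i)) (allFin n)

bitVectors : ∀ n → List (Vec Bool n)
bitVectors zero    = [] ∷ []
bitVectors (suc n) = map (false ∷_) (bitVectors n) ++ map (true ∷_) (bitVectors n)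

bitVectors-enumerates : ∀ n → IsEnumeration (setoid (Vec Bool n)) (bitVectors n)
bitVectors-enumerates zero    []          = here refl
bitVectors-enumerates (suc n) (false ∷ x) =
  ∈-++⁺ˡ (∈-map⁺ (false ∷_) (bitVectors-enumerates n x))
bitVectors-enumerates (suc n) (true ∷ x)  =
  ∈-++⁺ʳ (map (false ∷_) (bitVectors n)) (∈-map⁺ (true ∷_) (bitVectors-enumerates n x))

hypercube : ℕ → FiniteSimpleGraph
hypercube n = record
  { V          = Vec Bool n
  ; _≟_        = ≡-dec Bool._≟_
  ; vertices   = bitVectors n
  ; enumerates = bitVectors-enumerates n
  ; Adj        = Adjacent
  ; adj?       = λ x y → length (differingCoordinates x y) ℕ.≟ 1
  ; adj-sym    = λ {x} {y} xy → trans (cong length (differing-sym y x)) xy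
  ; adj-irrefl = irrefl
  }
  where
  Adjacent : Vec Bool n → Vec Bool n → Set
  Adjacent x y = length (differingCoordinates x y) ≡ 1

  differing-sym : ∀ x y → differingCoordinates x y ≡ differingCoordinates y x
  differing-sym x y =
    filter-≐ (λ i → ¬? (lookup x i Bool.≟ lookup y i))
             (λ i → ¬? (lookup y i Bool.≟ lookup x i))
             (≢-sym , ≢-sym) (allFin n)

  irrefl : Irreflexive _≡_ Adjacent
  irrefl {x} refl xx
    with () ← trans (sym (cong length
      (filter-none (λ i → ¬? (lookup x i Bool.≟ lookup x i))
                   (universal (λ i x≢x → x≢x refl) (allFin n))))) xx

Q₃ : FiniteSimpleGraph
Q₃ = hypercube 3

data Player : Set where
  Maker Breaker : Player

module DegreeGame (G : FiniteSimpleGraph) where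
  open FiniteSimpleGraph G

  -- An edge is presented by an ordered pair of adjacent vertices; the two
  -- orientations are identified by _≈_.
  record Edge : Set where
    constructor edge
    field
      src tgt : V
      adj     : Adj src tgt
  open Edge public

  _≈_ : Edge → Edge → Set
  e ≈ f = (src e ≡ src f × tgt e ≡ tgt f) ⊎ (src e ≡ tgt f × tgt e ≡ src f)

  Incident : V → Edge → Set
  Incident x e = x ≡ src e ⊎ x ≡ tgt e

  incident? : ∀ x e → Dec (Incident x e)
  incident? x e = (x ≟ src e) ⊎-dec (x ≟ tgt e)

  -- The edges claimed by each player, most recent first. As the turns
  -- alternate, this records the entire history of the play.
  record Position : Set where
    constructor position
    field
      makerEdges breakerEdges : List Edge
  open Position public

  Claimed : Position → Edge → Set
  Claimed p e = Any (e ≈_) (makerEdges p ++ breakerEdges p)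

  Over : Position → Set
  Over p = ∀ e → Claimed p e

  claim : Player → Edge → Position → Position
  claim Maker   e (position m b) = position (e ∷ m) b
  claim Breaker e (position m b) = position m (e ∷ b)

  BreakerStrategy : Set
  BreakerStrategy = ∀ p → ¬ Over p → Σ[ e ∈ Edge ] ¬ Claimed p e

  -- Play σ P p: the position p, with P to move, arises in a play in which
  -- Maker moves first and makes arbitrary legal moves and Breaker follows σ.
  data Play (σ : BreakerStrategy) : Player → Position → Set where
    start        : Play σ Maker (position [] [])
    makerMoves   : ∀ {p} → Play σ Maker p → (e : Edge) → ¬ Claimed p e →
                   Play σ Breaker (claim Maker e p)
    breakerMoves : ∀ {p} → Play σ Breaker p → (¬over : ¬ Over p) →
                   Play σ Maker (claim Breaker (proj₁ (σ p ¬over)) p)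

  -- No edge is claimed twice in a play, so counting list entries counts edges.
  breakerDegree : Position → V → ℕ
  breakerDegree p x = length (filter (incident? x) (breakerEdges p))

  BreakerWinsAt : ℕ → Position → Set
  BreakerWinsAt t p = ∀ x → t ≤ breakerDegree p x

  Winning : ℕ → BreakerStrategy → Set
  Winning t σ = ∀ {P p} → Play σ P p → Over p → BreakerWinsAt t p

BreakerHasWinningStrategy : ℕ → FiniteSimpleGraph → Set
BreakerHasWinningStrategy t G = ∃[ σ ] Winning t σ
  where open DegreeGame G

-- δ_B(G) = d. A relation rather than a function of G: there is no largest t
-- when G has no vertices.
δB[_]≡_ : FiniteSimpleGraph → ℕ → Set
δB[ G ]≡ d =
  BreakerHasWinningStrategy d G × (∀ t → BreakerHasWinningStrategy t G → t ≤ d)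

{-# OPTIONS --safe #-}
-- Breaker survives by brute force. A minimax search over the free edges and the vertices that
-- Breaker has not touched yet shows that he can cover every vertex within the six rounds, and
-- his strategy is to answer with any edge after which the search still succeeds. The search
-- stays small because, when Maker leaves a vertex with a single free edge, Breaker must take it.
--
-- He cannot reach degree 2 everywhere: Maker opens with an edge at 000 and then claims a second
-- one there, which leaves Breaker at most one edge at that vertex.
module Submission where

open import Defs
open import Data.Bool using (Bool; true; false; T)
open import Data.Bool.ListAction using (any; all)
open import Data.List using (List; []; _∷_; _++_; filter; length)
open import Data.List.Membership.Propositional using (_∈_; find; lose)
open import Data.List.Membership.Propositional.Properties using (∈-filter⁺; ∈-filter⁻)
open import Data.List.Properties
  using (filter-all; filter-accept; filter-reject; filter-≐; filter-some; filter-notAll; length-filter)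
open import Data.List.Relation.Unary.All as All using (All; all?)
open import Data.List.Relation.Unary.All.Properties using (all⁺; ¬All⇒Any¬)
open import Data.List.Relation.Unary.Any as Any using (Any; any?; here; there)
open import Data.List.Relation.Unary.Any.Properties
  using (¬Any[]; any⁻; filter⁻; ++-insert; ++⁺ˡ; ++⁺ʳ; ++⁻)
open import Data.Nat using (ℕ; zero; suc; pred; _+_; _∸_; _≤_; _<_; _≤?_; s≤s⁻¹)
open import Data.Nat.Induction using (Acc; acc; <-wellFounded)
open import Data.Nat.Properties
  using (≤-refl; ≤-reflexive; ≤-trans; ≤-<-trans; <-≤-trans; m≤m+n; +-suc;
         +-mono-≤; +-monoʳ-≤; +-monoʳ-<; pred[m∸n]≡m∸[1+n]; module ≤-Reasoning)
open import Data.Product using (Σ-syntax; ∃-syntax; _×_; _,_; proj₁; proj₂; swap)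
open import Data.Sum using (_⊎_; inj₁; inj₂; [_,_]′)
open import Data.Vec using ([]; _∷_)
open import Function using (_∘_; id)
open import Level using (Level)
open import Relation.Binary.PropositionalEquality
  using (_≡_; refl; sym; trans; cong; subst; subst₂)
open import Relation.Nullary
  using (¬_; Dec; yes; no; ¬?; _×-dec_; _⊎-dec_; _→-dec_; contradiction; toWitness; from-no)
open import Relation.Nullary.Decidable using (T?; decidable-stable)
open import Relation.Unary using (Pred; Decidable; _≐_; _∩_)

-- Iterated filters

private
  variable
    a ℓ₁ ℓ₂ ℓ₃ : Level
    A : Set a

-- Needed as an equality of lists: those recomputed from a position must coincide with those that
-- the search thins out move by move.
filter-filter : {P : Pred A ℓ₁} {Q : Pred A ℓ₂} {R : Pred A ℓ₃}
                (P? : Decidable P) (Q? : Decidable Q) (R? : Decidable R) →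
                R ≐ P ∩ Q → ∀ xs → filter R? xs ≡ filter P? (filter Q? xs)
filter-filter P? Q? R? R≐P∩Q [] = refl
filter-filter P? Q? R? R≐P∩Q@(to , from) (x ∷ xs) with Q? x
... | no ¬q = trans (filter-reject R? (¬q ∘ proj₂ ∘ to)) (filter-filter P? Q? R? R≐P∩Q xs)
... | yes q with P? x
...   | yes p = trans (filter-accept R? (from (p , q))) (cong (x ∷_) (filter-filter P? Q? R? R≐P∩Q xs))
...   | no ¬p = trans (filter-reject R? (¬p ∘ proj₁ ∘ to)) (filter-filter P? Q? R? R≐P∩Q xs)

filter-comm : {P : Pred A ℓ₁} {Q : Pred A ℓ₂} (P? : Decidable P) (Q? : Decidable Q) →
              ∀ xs → filter P? (filter Q? xs) ≡ filter Q? (filter P? xs)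
filter-comm P? Q? xs =
  trans (sym (filter-filter P? Q? (λ x → P? x ×-dec Q? x) (id , id) xs))
        (filter-filter Q? P? (λ x → P? x ×-dec Q? x) (swap , swap) xs)

module Search (G : FiniteSimpleGraph)
              (edges : List (DegreeGame.Edge G))
              (edges-complete : ∀ e → Any (DegreeGame._≈_ G e) edges) where
  open FiniteSimpleGraph G
  open DegreeGame G

  -- Edges up to orientation

  ≈-refl : ∀ {e} → e ≈ e
  ≈-refl = inj₁ (refl , refl)

  ≈-sym : ∀ e f → e ≈ f → f ≈ e
  ≈-sym e f (inj₁ (s , t)) = inj₁ (sym s , sym t)
  ≈-sym e f (inj₂ (s , t)) = inj₂ (sym t , sym s)

  ≈-trans : ∀ e f g → e ≈ f → f ≈ g → e ≈ g
  ≈-trans e f g (inj₁ (refl , refl)) f≈g                  = f≈g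
  ≈-trans e f g (inj₂ (refl , refl)) (inj₁ (refl , refl)) = inj₂ (refl , refl)
  ≈-trans e f g (inj₂ (refl , refl)) (inj₂ (refl , refl)) = inj₁ (refl , refl)

  _≈?_ : ∀ e f → Dec (e ≈ f)
  e ≈? f = ((src e ≟ src f) ×-dec (tgt e ≟ tgt f)) ⊎-dec ((src e ≟ tgt f) ×-dec (tgt e ≟ src f))

  Incident-resp-≈ : ∀ {x} e f → e ≈ f → Incident x e → Incident x f
  Incident-resp-≈ e f (inj₁ (refl , refl)) = id
  Incident-resp-≈ e f (inj₂ (refl , refl)) = [ inj₂ , inj₁ ]′

  infixl 6 _∖_ _⊖_

  _∖_ : List Edge → Edge → List Edge
  F ∖ e = filter (λ f → ¬? (e ≈? f)) F

  _⊖_ : List V → Edge → List V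
  O ⊖ e = filter (λ x → ¬? (incident? x e)) O

  degree : List Edge → V → ℕ
  degree F x = length (filter (incident? x) F)

  ∖-resp-≈ : ∀ e f → e ≈ f → ∀ F → F ∖ e ≡ F ∖ f
  ∖-resp-≈ e f e≈f =
    filter-≐ (λ g → ¬? (e ≈? g)) (λ g → ¬? (f ≈? g))
             ( (λ {g} → _∘ ≈-trans e f g e≈f)
             , (λ {g} → _∘ ≈-trans f e g (≈-sym e f e≈f)))

  length-∖-≤ : ∀ F e → length (F ∖ e) ≤ length F
  length-∖-≤ F e = length-filter (λ f → ¬? (e ≈? f)) F

  length-∖-< : ∀ {F} e → Any (e ≈_) F → length (F ∖ e) < length F
  length-∖-< {F} e e∈F = filter-notAll (λ f → ¬? (e ≈? f)) F (Any.map contradiction e∈F)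

  -- Free edges and uncovered vertices of a position

  claimed? : ∀ p e → Dec (Claimed p e)
  claimed? p e = any? (e ≈?_) (makerEdges p ++ breakerEdges p)

  free : Position → List Edge
  free p = filter (λ e → ¬? (claimed? p e)) edges

  Covered : Position → V → Set
  Covered p x = Any (Incident x) (breakerEdges p)

  covered? : ∀ p x → Dec (Covered p x)
  covered? p x = any? (incident? x) (breakerEdges p)

  uncovered : Position → List V
  uncovered p = filter (λ x → ¬? (covered? p x)) vertices

  Claimed-resp-≈ : ∀ p e f → e ≈ f → Claimed p e → Claimed p f
  Claimed-resp-≈ p e f e≈f = Any.map (λ {g} → ≈-trans f e g (≈-sym e f e≈f))

  claimed-now : ∀ P p e f → e ≈ f → Claimed (claim P f p) e
  claimed-now Maker   p e f e≈f = here e≈f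
  claimed-now Breaker p e f e≈f = ++-insert (makerEdges p) e≈f

  claimed-before : ∀ P p e {f} → Claimed p e → Claimed (claim P f p) e
  claimed-before Maker   p e c = there c
  claimed-before Breaker p e c =
    [ ++⁺ˡ , ++⁺ʳ (makerEdges p) ∘ there ]′ (++⁻ (makerEdges p) c)

  claimed-after : ∀ P p e {f} → Claimed (claim P f p) e → e ≈ f ⊎ Claimed p e
  claimed-after Maker   p e (here e≈f) = inj₁ e≈f
  claimed-after Maker   p e (there c)  = inj₂ c
  claimed-after Breaker p e c with ++⁻ (makerEdges p) c
  ... | inj₁ m           = inj₂ (++⁺ˡ m)
  ... | inj₂ (here e≈f)  = inj₁ e≈f
  ... | inj₂ (there b)   = inj₂ (++⁺ʳ (makerEdges p) b)

  unclaimed⇒free : ∀ p e → ¬ Claimed p e → Any (e ≈_) (free p)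
  unclaimed⇒free p e ¬c with find (edges-complete e)
  ... | f , f∈ , e≈f =
    lose (∈-filter⁺ (λ g → ¬? (claimed? p g)) f∈ (¬c ∘ Claimed-resp-≈ p f e (≈-sym e f e≈f))) e≈f

  free⇒unclaimed : ∀ {p e} → e ∈ free p → ¬ Claimed p e
  free⇒unclaimed {p} = proj₂ ∘ ∈-filter⁻ (λ e → ¬? (claimed? p e)) {xs = edges}

  over⇒free-[] : ∀ {p} → Over p → free p ≡ []
  over⇒free-[] {p} over with free p in eq
  ... | []    = refl
  ... | e ∷ _ = contradiction (over e) (free⇒unclaimed {p} (subst (e ∈_) (sym eq) (here refl)))

  over-or-move : ∀ p → Over p ⊎ ∃[ e ] ¬ Claimed p e
  over-or-move p with all? (claimed? p) edges
  ... | yes allClaimed = inj₁ λ e →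
    let f , f∈ , e≈f = find (edges-complete e)
    in  Claimed-resp-≈ p f e (≈-sym e f e≈f) (All.lookup allClaimed f∈)
  ... | no ¬allClaimed =
    let e , _ , ¬c = find (¬All⇒Any¬ (claimed? p) edges ¬allClaimed) in inj₂ (e , ¬c)

  free-claim : ∀ P p e → free (claim P e p) ≡ free p ∖ e
  free-claim P p e =
    filter-filter (λ f → ¬? (e ≈? f)) (λ f → ¬? (claimed? p f)) (λ f → ¬? (claimed? (claim P e p) f))
      ( (λ {f} ¬c → ¬c ∘ claimed-now P p f e ∘ ≈-sym e f , ¬c ∘ claimed-before P p f)
      , (λ {f} (e≉f , ¬c) → [ e≉f ∘ ≈-sym f e , ¬c ]′ ∘ claimed-after P p f) )
      edges

  uncovered-claim : ∀ p e → uncovered (claim Breaker e p) ≡ uncovered p ⊖ e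
  uncovered-claim p e =
    filter-filter (λ x → ¬? (incident? x e)) (λ x → ¬? (covered? p x))
      (λ x → ¬? (covered? (claim Breaker e p) x))
      ( (λ ¬c → ¬c ∘ here , ¬c ∘ there)
      , (λ (¬i , ¬c) → λ { (here i) → ¬i i ; (there c) → ¬c c }) )
      vertices

  uncovered-[]⇒wins : ∀ {p} → uncovered p ≡ [] → BreakerWinsAt 1 p
  uncovered-[]⇒wins {p} none x =
    filter-some (incident? x) (decidable-stable (covered? p x) λ ¬c →
      ¬Any[] (subst (x ∈_) none (∈-filter⁺ (λ y → ¬? (covered? p y)) (enumerates x) ¬c)))

  -- The minimax search

  -- A vertex with at most one free edge left is lost unless Breaker answers there at once.
  threatened : List Edge → List V → List V
  threatened F O = filter (λ x → degree F x ≤? 1) O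

  -- With nothing threatened every free edge qualifies; two threatened vertices leave at most the
  -- edge joining them.
  answers : List Edge → List V → List Edge
  answers F O = filter (λ f → all? (λ x → incident? x f) (threatened F O)) F

  -- Minimax over the free edges F and the vertices O not yet covered by Breaker: Maker is to
  -- move in survives, Breaker in answerable.
  survives   : ℕ → List Edge → List V → Bool
  answerable : ℕ → List Edge → List V → Bool
  survives n       F         []        = true
  survives zero    F         (_ ∷ _)   = false
  -- Explicit, because `all` over an empty board would hold vacuously with vertices still uncovered.
  survives (suc n) []        (_ ∷ _)   = false
  survives (suc n) F@(_ ∷ _) O@(_ ∷ _) = all (λ e → answerable n (F ∖ e) O) F
  answerable n F O = any (λ f → survives n (F ∖ f) (O ⊖ f)) (answers F O)

  Survives : ℕ → List Edge → List V → Set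
  Survives n F O = T (survives n F O)

  -- The pruning to `answers` is dropped: a good answer among the forced edges is a good answer
  -- among all free ones.
  Answerable : ℕ → List Edge → List V → Set
  Answerable n F O = Any (λ f → Survives n (F ∖ f) (O ⊖ f)) F

  survives⇒answerable : ∀ n {F O e} → Survives n F O → e ∈ F → O ≡ [] ⊎ Answerable (pred n) (F ∖ e) O
  survives⇒answerable n       {F}         {[]}        _ _   = inj₁ refl
  survives⇒answerable (suc n) {F@(_ ∷ _)} {O@(_ ∷ _)} {e} s e∈F =
    inj₂ (filter⁻ (λ f → all? (λ x → incident? x f) (threatened (F ∖ e) O))
            (any⁻ _ (answers (F ∖ e) O) (All.lookup (all⁺ _ F s) e∈F)))

  survives-[] : ∀ n {O} → Survives n [] O → O ≡ []
  survives-[] n       {[]}    _ = refl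
  survives-[] zero    {_ ∷ _} ()
  survives-[] (suc n) {_ ∷ _} ()

  -- Breaker's strategy and its invariant

  module _ (rounds : ℕ) where

    -- Only Maker's claims are counted: Maker's edge opens a round, and Breaker's answer belongs to
    -- the same round.
    remaining : Position → ℕ
    remaining p = rounds ∸ length (makerEdges p)

    Answer : Position → Set
    Answer p = Answerable (remaining p) (free p) (uncovered p)

    answer? : ∀ p → Dec (Answer p)
    answer? p = any? (λ _ → T? _) (free p)

    -- The decision is an argument so that the invariant proof can split on it. A strategy must be
    -- total, so any unclaimed edge serves when the search fails; at a safe position this leaves
    -- only the case that every vertex is covered.
    choose : ∀ {p} → ¬ Over p → Dec (Answer p) → Σ[ e ∈ Edge ] ¬ Claimed p e
    choose {p} _ (yes answer) = let e , e∈ , _ = find answer in e , free⇒unclaimed {p} e∈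
    choose {p} ¬over (no _)   = [ (λ over → contradiction over ¬over) , id ]′ (over-or-move p)

    strategy : BreakerStrategy
    strategy p ¬over = choose ¬over (answer? p)

    -- The invariant of every play. Once all vertices are covered the search succeeds without
    -- looking at the board, so it promises no free edge to answer with; hence Breaker's first
    -- alternative.
    Safe : Player → Position → Set
    Safe Maker   p = Survives (remaining p) (free p) (uncovered p)
    Safe Breaker p = uncovered p ≡ [] ⊎ Answer p

    safe-after-Maker : ∀ p e → Safe Maker p → ¬ Claimed p e → Safe Breaker (claim Maker e p)
    -- Maker may name an edge in the orientation opposite to the listed one; the search knows only
    -- the listed `f`.
    safe-after-Maker p e s ¬c with find (unclaimed⇒free p e ¬c)
    ... | f , f∈ , e≈f with survives⇒answerable (remaining p) s f∈
    ...   | inj₁ none = inj₁ none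
    ...   | inj₂ ans  = inj₂ (subst₂ (λ n F → Answerable n F (uncovered p))
                          (pred[m∸n]≡m∸[1+n] rounds (length (makerEdges p)))
                          (trans (sym (∖-resp-≈ e f e≈f (free p))) (sym (free-claim Maker p e)))
                          ans)

    safe-after-Breaker : ∀ {p} (¬over : ¬ Over p) (d : Dec (Answer p)) → Safe Breaker p →
                         Safe Maker (claim Breaker (proj₁ (choose ¬over d)) p)
    safe-after-Breaker {p} ¬over (yes answer) _ =
      let f , _ , s = find answer
      in  subst₂ (Survives (remaining p)) (sym (free-claim Breaker p f)) (sym (uncovered-claim p f)) s
    safe-after-Breaker ¬over (no ¬answer) (inj₂ answer) = contradiction answer ¬answer
    safe-after-Breaker {p} ¬over d@(no _) (inj₁ none) =
      -- `[] ⊖ f` computes to `[]`, where the search succeeds at any depth.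
      subst (Survives (remaining p) (free (claim Breaker f p)))
            (sym (trans (uncovered-claim p f) (cong (_⊖ f) none))) _
      where f = proj₁ (choose ¬over d)

    play-safe : Survives rounds edges vertices → ∀ {P p} → Play strategy P p → Safe P p
    play-safe s start =
      subst₂ (Survives rounds) (sym (filter-all _ (All.universal (λ _ ()) edges)))
                               (sym (filter-all _ (All.universal (λ _ ()) vertices))) s
    play-safe s (makerMoves {p} play e ¬c) =
      safe-after-Maker p e (play-safe s play) ¬c
    play-safe s (breakerMoves {p} play ¬over) =
      safe-after-Breaker ¬over (answer? p) (play-safe s play)

    -- On a full board the search has no edges left, so it succeeds only with nothing uncovered; an
    -- answer for Breaker would be an unclaimed edge.
    safe-over⇒wins : ∀ P {p} → Safe P p → Over p → BreakerWinsAt 1 p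
    safe-over⇒wins Maker {p} s over =
      uncovered-[]⇒wins {p} (survives-[] (remaining p)
        (subst (λ F → Survives (remaining p) F (uncovered p)) (over⇒free-[] {p} over) s))
    safe-over⇒wins Breaker {p} (inj₁ none) over = uncovered-[]⇒wins {p} none
    safe-over⇒wins Breaker {p} (inj₂ answer) over =
      let e , e∈ , _ = find answer in contradiction (over e) (free⇒unclaimed {p} e∈)

    survives⇒winning : survives rounds edges vertices ≡ true → BreakerHasWinningStrategy 1 G
    survives⇒winning s = strategy , λ {P} play → safe-over⇒wins P (play-safe (subst T (sym s) _) play)

  -- Upper bounds on the degree that Breaker can reach

  -- Bounds Breaker's final degree at x: it never increases, and each edge that Maker claims
  -- at x lowers it.
  available : Position → V → ℕ
  available p x = breakerDegree p x + degree (free p) x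

  degree-∖ : ∀ F e x → degree (F ∖ e) x ≡ length (filter (incident? x) F ∖ e)
  degree-∖ F e x = cong length (filter-comm (incident? x) (λ f → ¬? (e ≈? f)) F)

  degree-∖-≤ : ∀ F e x → degree (F ∖ e) x ≤ degree F x
  degree-∖-≤ F e x = ≤-trans (≤-reflexive (degree-∖ F e x)) (length-∖-≤ (filter (incident? x) F) e)

  degree-∖-< : ∀ {F} e {x} → Incident x e → Any (e ≈_) F → degree (F ∖ e) x < degree F x
  degree-∖-< {F} e {x} i e∈F =
    let f , f∈ , e≈f = find e∈F
    in  ≤-<-trans (≤-reflexive (degree-∖ F e x))
          (length-∖-< e (lose (∈-filter⁺ (incident? x) f∈ (Incident-resp-≈ e f e≈f i)) e≈f))

  free-degree-≤ : ∀ P p e x → degree (free (claim P e p)) x ≤ degree (free p) x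
  free-degree-≤ P p e x rewrite free-claim P p e = degree-∖-≤ (free p) e x

  free-degree-< : ∀ P p e {x} → Incident x e → ¬ Claimed p e →
                  degree (free (claim P e p)) x < degree (free p) x
  free-degree-< P p e i ¬c rewrite free-claim P p e = degree-∖-< e i (unclaimed⇒free p e ¬c)

  available-drops : ∀ p e {x} → Incident x e → ¬ Claimed p e →
                    available (claim Maker e p) x < available p x
  available-drops p e {x} i ¬c = +-monoʳ-< (breakerDegree p x) (free-degree-< Maker p e i ¬c)

  available-≤ : ∀ P p e x → ¬ Claimed p e → available (claim P e p) x ≤ available p x
  available-≤ Maker   p e x ¬c = +-monoʳ-≤ (breakerDegree p x) (free-degree-≤ Maker p e x)
  available-≤ Breaker p e x ¬c with incident? x e
  ... | no ¬i = +-mono-≤ (≤-reflexive (cong length (filter-reject (incident? x) ¬i)))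
                         (free-degree-≤ Breaker p e x)
  -- Breaker's edge at `x` passes from the second summand to the first: one gains 1, the other loses
  -- at least 1.
  ... | yes i = begin
    degree (e ∷ breakerEdges p) x + rest  ≡⟨ cong (λ B → length B + rest) (filter-accept (incident? x) i) ⟩
    suc (breakerDegree p x) + rest        ≡⟨ +-suc (breakerDegree p x) rest ⟨
    breakerDegree p x + suc rest          ≤⟨ +-monoʳ-≤ (breakerDegree p x) (free-degree-< Breaker p e i ¬c) ⟩
    available p x                         ∎
    where
    open ≤-Reasoning
    rest = degree (free (claim Breaker e p)) x

  Completion : BreakerStrategy → Position → Set
  Completion σ p = ∃[ P ] ∃[ q ] Play σ P q × Over q × (∀ x → available q x ≤ available p x)

  -- `Winning` speaks only of finished plays. The free edges decrease with every move, so Maker can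
  -- go on with any unclaimed edge until the board is full, and no move on the way raises
  -- `available`.
  complete : ∀ {σ P p} → Play σ P p → Completion σ p
  complete play = go play (<-wellFounded _)
    where
    go : ∀ {σ P p} → Play σ P p → Acc _<_ (length (free p)) → Completion σ p
    go {σ} {P} {p} play (acc rec) with over-or-move p
    ... | inj₁ over = P , p , play , over , λ x → ≤-refl
    ... | inj₂ (e , ¬c) = turn P play
      where
      continue : ∀ Q {Q′} f → ¬ Claimed p f → Play σ Q′ (claim Q f p) → Completion σ p
      continue Q f ¬cf next =
        let P′ , q , play′ , over , le = go next (rec shrinks)
        in  P′ , q , play′ , over , λ x → ≤-trans (le x) (available-≤ Q p f x ¬cf)
        where
        shrinks : length (free (claim Q f p)) < length (free p)
        shrinks rewrite free-claim Q p f = length-∖-< f (unclaimed⇒free p f ¬cf)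
      turn : ∀ P → Play σ P p → Completion σ p
      turn Maker   play = continue Maker e ¬c (makerMoves play e ¬c)
      turn Breaker play =
        continue Breaker _ (proj₂ (σ p ¬over)) (breakerMoves play ¬over)
        where
        ¬over : ¬ Over p
        ¬over over = ¬c (over e)

  -- Lets a play be judged before its end: at its completion `t` is at most Breaker's degree, hence
  -- at most `available`, which was no smaller at `p`.
  winning⇒≤available : ∀ {t σ P p} → Winning t σ → Play σ P p → ∀ x → t ≤ available p x
  winning⇒≤available win play x =
    let _ , q , play′ , over , le = complete play
    in  ≤-trans (win play′ over x) (≤-trans (m≤m+n _ _) (le x))

-- The cube

open FiniteSimpleGraph Q₃ using (V; vertices; enumerates; _≟_; Adj; adj?)
open DegreeGame Q₃

pattern o = false
pattern l = true

-- Grouped by direction: four edges for each coordinate in turn.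
cubeEdges : List Edge
cubeEdges =
  edge (o ∷ o ∷ o ∷ []) (l ∷ o ∷ o ∷ []) refl ∷ edge (o ∷ l ∷ o ∷ []) (l ∷ l ∷ o ∷ []) refl ∷
  edge (o ∷ o ∷ l ∷ []) (l ∷ o ∷ l ∷ []) refl ∷ edge (o ∷ l ∷ l ∷ []) (l ∷ l ∷ l ∷ []) refl ∷
  edge (o ∷ o ∷ o ∷ []) (o ∷ l ∷ o ∷ []) refl ∷ edge (l ∷ o ∷ o ∷ []) (l ∷ l ∷ o ∷ []) refl ∷
  edge (o ∷ o ∷ l ∷ []) (o ∷ l ∷ l ∷ []) refl ∷ edge (l ∷ o ∷ l ∷ []) (l ∷ l ∷ l ∷ []) refl ∷
  edge (o ∷ o ∷ o ∷ []) (o ∷ o ∷ l ∷ []) refl ∷ edge (l ∷ o ∷ o ∷ []) (l ∷ o ∷ l ∷ []) refl ∷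
  edge (o ∷ l ∷ o ∷ []) (o ∷ l ∷ l ∷ []) refl ∷ edge (l ∷ l ∷ o ∷ []) (l ∷ l ∷ l ∷ []) refl ∷ []

-- `edge x y xy ≈ f` unfolds to this; leaving out the adjacency proof lets completeness of the edge
-- list be decided over all pairs of vertices.
Joins : V → V → Edge → Set
Joins x y f = (x ≡ src f × y ≡ tgt f) ⊎ (x ≡ tgt f × y ≡ src f)

cubeEdges-complete : ∀ e → Any (e ≈_) cubeEdges
cubeEdges-complete (edge x y xy) =
  All.lookup (All.lookup allJoined (enumerates x)) (enumerates y) xy
  where
  joins? : ∀ x y f → Dec (Joins x y f)
  joins? x y f = ((x ≟ src f) ×-dec (y ≟ tgt f)) ⊎-dec ((x ≟ tgt f) ×-dec (y ≟ src f))

  allJoined : All (λ x → All (λ y → Adj x y → Any (Joins x y) cubeEdges) vertices) vertices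
  allJoined = toWitness
    {a? = all? (λ x → all? (λ y → adj? x y →-dec any? (joins? x y) cubeEdges) vertices) vertices} _

open Search Q₃ cubeEdges cubeEdges-complete

Q₃-winning₁ : BreakerHasWinningStrategy 1 Q₃
-- refl runs the minimax search on the empty board.
Q₃-winning₁ = survives⇒winning 6 refl

module _ {t σ} (winning : Winning t σ) where

  x₀ : V
  x₀ = o ∷ o ∷ o ∷ []

  e₁ e₂ e₃ : Edge
  e₁ = edge x₀ (l ∷ o ∷ o ∷ []) refl
  e₂ = edge x₀ (o ∷ l ∷ o ∷ []) refl
  e₃ = edge x₀ (o ∷ o ∷ l ∷ []) refl

  p₁ : Position
  p₁ = claim Maker e₁ (position [] [])

  ¬over₁ : ¬ Over p₁
  ¬over₁ over = from-no (claimed? p₁ e₂) (over e₂)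

  f : Edge
  f = proj₁ (σ p₁ ¬over₁)

  p₂ : Position
  p₂ = claim Breaker f p₁

  play₂ : Play σ Maker p₂
  play₂ = breakerMoves (makerMoves start e₁ λ ()) ¬over₁

  -- Breaker's single reply blocks at most one of the two other edges at `x₀`.
  second-edge : ∃[ e ] Incident x₀ e × ¬ Claimed p₂ e
  second-edge with f ≈? e₂
  ... | no  f≉e₂ = e₂ , inj₁ refl , λ
    { (here e₂≈e₁)         → from-no (e₂ ≈? e₁) e₂≈e₁
    ; (there (here e₂≈f)) → f≉e₂ (≈-sym e₂ f e₂≈f) }
  ... | yes f≈e₂ = e₃ , inj₁ refl , λ
    { (here e₃≈e₁)         → from-no (e₃ ≈? e₁) e₃≈e₁
    ; (there (here e₃≈f)) → from-no (e₃ ≈? e₂) (≈-trans e₃ f e₂ e₃≈f f≈e₂) }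

  Q₃-winning-≤1 : t ≤ 1
  Q₃-winning-≤1 =
    let e , i , ¬c = second-edge in
    -- Innermost first: `available` at `x₀` is 3 on the empty board, below 3 after `e₁`, not raised
    -- by Breaker's `f`, and below 2 after the second edge.
    ≤-trans (winning⇒≤available winning (makerMoves play₂ e ¬c) x₀)
      (s≤s⁻¹ (<-≤-trans (available-drops p₂ e i ¬c)
        (≤-trans (available-≤ Breaker p₁ f x₀ (proj₂ (σ p₁ ¬over₁)))
          (s≤s⁻¹ (available-drops (position [] []) e₁ (inj₁ refl) λ ())))))

lemma6 : BreakerHasWinningStrategy 1 Q₃ × δB[ Q₃ ]≡ 1
lemma6 = Q₃-winning₁ , Q₃-winning₁ , λ t (σ , winning) → Q₃-winning-≤1 winning
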